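{- Let $n$ be an odd positive integer. A sequence $S$ in $\mathbb{Z}_n$ is a $U(n)$-extremal sequence for the Gao constant if and only if there exist (not necessarily distinct) primes $p_1,\ldots,p_k$ with $n=p_1p_2\cdots p_k$ (in some order) and integers $b_1,\ldots,b_k$ with $b_i$ coprime to $p_i$ for each $1\le i\le k$, such that $S$ is $U(n)$-equivalent to the sequence $$(b_1,\ p_1b_2,\ p_1p_2b_3,\ \ldots,\ p_1p_2\cdots p_{k-1}b_k,\ \underbrace{0,\ldots,0}_{n-1\text{ times}}).$$
   Context: $\mathbb{Z}_n=\mathbb{Z}/n\mathbb{Z}$ and $U(n)$ is its group of units; integers are identified with their images in $\mathbb{Z}_n$. A sequence is a finite list $(x_1,\ldots,x_l)$ of elements of $\mathbb{Z}_n$ (repetitions allowed); a subsequence is obtained by restricting to a subset of the indices. For $A\subseteq\mathbb{Z}_n$, a subsequence of $(x_1,\ldots,x_l)$ with index set $I$ is an $A$-weighted zero-sum subsequence if $I\ne\emptyset$ and there exist $a_i\in A$ ($i\in I$) with $\sum_{i\in I}a_ix_i=0$. The $A$-weighted Gao constant $E_A(n)$ is the least positive integer $k$ such that every sequence of length $k$ in $\mathbb{Z}_n$ has an $A$-weighted zero-sum subsequence of length $n$. An $A$-extremal sequence for the Gao constant is a sequence in $\mathbb{Z}_n$ of length $E_A(n)-1$ which has no $A$-weighted zero-sum subsequence of length $n$. For a subgroup $A$ of $U(n)$, two sequences $(x_1,\ldots,x_l)$ and $(y_1,\ldots,y_l)$ in $\mathbb{Z}_n$ are $A$-equivalent if there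 exist $c\in U(n)$, a permutation $\sigma$ of $\{1,\ldots,l\}$ and $a_1,\ldots,a_l\in A$ such that $c\,y_{\sigma(i)}=a_ix_i$ for all $1\le i\le l$. -}

module Defs where

open import Algebra.Bundles using (CommutativeRing)
open import Algebra.Structures using (IsCommutativeRing)
open import Data.Bool.Base using (if_then_else_)
open import Data.Fin.Base using (Fin′; inject)
open import Data.Fin.Permutation using (Permutation; _⟨$⟩ʳ_)
open import Data.Fin.Subset using (Subset; Nonempty; ∣_∣; _∈_)
open import Data.Integer.Base as ℤ using (ℤ; +_; 0ℤ; 1ℤ)
import Data.Integer.Properties as ℤ
open import Data.Integer.Divisibility.Signed using (_∣_; divides)
open import Data.Integer.Tactic.RingSolver using (solve-∀)
open import Data.Nat.Base as ℕ using (ℕ)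
open import Data.Product.Base using (_×_; _,_; ∃-syntax; Σ-syntax)
open import Data.Vec.Base using (lookup)
open import Data.Vec.Functional using (Vector; foldr; replicate; _++_)
open import Level using (0ℓ)
open import Relation.Binary.Definitions using (_Respects_)
open import Relation.Binary.PropositionalEquality
  using (_≡_; refl; cong; cong₂; module ≡-Reasoning)
open import Relation.Nullary using (¬_)
open import Relation.Unary using (Pred)

-- ℤ/nℤ is the setoid-based ring whose carrier is ℤ and whose equality is
-- congruence modulo n, so identifying an integer with its residue class is
-- the identity function.

module _ (n : ℕ) where

  infix 4 _≡ₙ_

  -- A record rather than a function, so that x and y can be inferred.
  record _≡ₙ_ (x y : ℤ) : Set where
    constructor congruent
    field n∣x-y : + n ∣ x ℤ.- y

  private

    ≡⇒≡ₙ : ∀ {x y} → x ≡ y → x ≡ₙ y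
    ≡⇒≡ₙ {x} refl = congruent (divides 0ℤ (ℤ.+-inverseʳ x))

    ≡ₙ-sym : ∀ {x y} → x ≡ₙ y → y ≡ₙ x
    ≡ₙ-sym {x} {y} (congruent (divides q eq)) = congruent (divides (ℤ.- q) (begin
      y ℤ.- x            ≡⟨ lemma x y ⟩
      ℤ.- (x ℤ.- y)      ≡⟨ cong ℤ.-_ eq ⟩
      ℤ.- (q ℤ.* + n)    ≡⟨ ℤ.neg-distribˡ-* q (+ n) ⟩
      ℤ.- q ℤ.* + n      ∎))
      where
      open ≡-Reasoning
      lemma : ∀ a b → b ℤ.- a ≡ ℤ.- (a ℤ.- b)
      lemma = solve-∀

    ≡ₙ-trans : ∀ {x y z} → x ≡ₙ y → y ≡ₙ z → x ≡ₙ z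
    ≡ₙ-trans {x} {y} {z} (congruent (divides q eq)) (congruent (divides r eq′)) =
      congruent (divides (q ℤ.+ r) (begin
      x ℤ.- z                       ≡⟨ lemma x y z ⟩
      (x ℤ.- y) ℤ.+ (y ℤ.- z)       ≡⟨ cong₂ ℤ._+_ eq eq′ ⟩
      q ℤ.* + n ℤ.+ r ℤ.* + n       ≡⟨ ℤ.*-distribʳ-+ (+ n) q r ⟨
      (q ℤ.+ r) ℤ.* + n             ∎))
      where
      open ≡-Reasoning
      lemma : ∀ a b c → a ℤ.- c ≡ (a ℤ.- b) ℤ.+ (b ℤ.- c)
      lemma = solve-∀

    +-cong : ∀ {x y u v} → x ≡ₙ y → u ≡ₙ v → x ℤ.+ u ≡ₙ y ℤ.+ v
    +-cong {x} {y} {u} {v} (congruent (divides q eq)) (congruent (divides r eq′)) =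
      congruent (divides (q ℤ.+ r) (begin
      (x ℤ.+ u) ℤ.- (y ℤ.+ v)       ≡⟨ lemma x y u v ⟩
      (x ℤ.- y) ℤ.+ (u ℤ.- v)       ≡⟨ cong₂ ℤ._+_ eq eq′ ⟩
      q ℤ.* + n ℤ.+ r ℤ.* + n       ≡⟨ ℤ.*-distribʳ-+ (+ n) q r ⟨
      (q ℤ.+ r) ℤ.* + n             ∎))
      where
      open ≡-Reasoning
      lemma : ∀ a b c d → (a ℤ.+ c) ℤ.- (b ℤ.+ d) ≡ (a ℤ.- b) ℤ.+ (c ℤ.- d)
      lemma = solve-∀

    *-cong : ∀ {x y u v} → x ≡ₙ y → u ≡ₙ v → x ℤ.* u ≡ₙ y ℤ.* v
    *-cong {x} {y} {u} {v} (congruent (divides q eq)) (congruent (divides r eq′)) =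
      congruent (divides (q ℤ.* u ℤ.+ y ℤ.* r) (begin
      x ℤ.* u ℤ.- y ℤ.* v                           ≡⟨ lemma x y u v ⟩
      (x ℤ.- y) ℤ.* u ℤ.+ y ℤ.* (u ℤ.- v)           ≡⟨ cong₂ (λ s t → s ℤ.* u ℤ.+ y ℤ.* t) eq eq′ ⟩
      (q ℤ.* + n) ℤ.* u ℤ.+ y ℤ.* (r ℤ.* + n)       ≡⟨ lemma′ q r u y (+ n) ⟩
      (q ℤ.* u ℤ.+ y ℤ.* r) ℤ.* + n                 ∎))
      where
      open ≡-Reasoning
      lemma : ∀ a b c d → a ℤ.* c ℤ.- b ℤ.* d ≡ (a ℤ.- b) ℤ.* c ℤ.+ b ℤ.* (c ℤ.- d)
      lemma = solve-∀
      lemma′ : ∀ a b c d m →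
               (a ℤ.* m) ℤ.* c ℤ.+ d ℤ.* (b ℤ.* m) ≡ (a ℤ.* c ℤ.+ d ℤ.* b) ℤ.* m
      lemma′ = solve-∀

    -‿cong : ∀ {x y} → x ≡ₙ y → ℤ.- x ≡ₙ ℤ.- y
    -‿cong {x} {y} (congruent (divides q eq)) = congruent (divides (ℤ.- q) (begin
      ℤ.- x ℤ.- (ℤ.- y)  ≡⟨ lemma x y ⟩
      ℤ.- (x ℤ.- y)      ≡⟨ cong ℤ.-_ eq ⟩
      ℤ.- (q ℤ.* + n)    ≡⟨ ℤ.neg-distribˡ-* q (+ n) ⟩
      ℤ.- q ℤ.* + n      ∎))
      where
      open ≡-Reasoning
      lemma : ∀ a b → ℤ.- a ℤ.- (ℤ.- b) ≡ ℤ.- (a ℤ.- b)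
      lemma = solve-∀

  ℤ/-isCommutativeRing : IsCommutativeRing _≡ₙ_ ℤ._+_ ℤ._*_ ℤ.-_ 0ℤ 1ℤ
  ℤ/-isCommutativeRing = record
    { isRing = record
      { +-isAbelianGroup = record
        { isGroup = record
          { isMonoid = record
            { isSemigroup = record
              { isMagma = record
                { isEquivalence = record
                  { refl = ≡⇒≡ₙ refl ; sym = ≡ₙ-sym ; trans = ≡ₙ-trans }
                ; ∙-cong = +-cong
                }
              ; assoc = λ x y z → ≡⇒≡ₙ (ℤ.+-assoc x y z)
              }
            ; identity = (λ x → ≡⇒≡ₙ (ℤ.+-identityˡ x)) , (λ x → ≡⇒≡ₙ (ℤ.+-identityʳ x))
            }
          ; inverse = (λ x → ≡⇒≡ₙ (ℤ.+-inverseˡ x)) , (λ x → ≡⇒≡ₙ (ℤ.+-inverseʳ x))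
          ; ⁻¹-cong = -‿cong
          }
        ; comm = λ x y → ≡⇒≡ₙ (ℤ.+-comm x y)
        }
      ; *-cong = *-cong
      ; *-assoc = λ x y z → ≡⇒≡ₙ (ℤ.*-assoc x y z)
      ; *-identity = (λ x → ≡⇒≡ₙ (ℤ.*-identityˡ x)) , (λ x → ≡⇒≡ₙ (ℤ.*-identityʳ x))
      ; distrib = (λ x y z → ≡⇒≡ₙ (ℤ.*-distribˡ-+ x y z))
                , (λ x y z → ≡⇒≡ₙ (ℤ.*-distribʳ-+ x y z))
      }
    ; *-comm = λ x y → ≡⇒≡ₙ (ℤ.*-comm x y)
    }

ℤ/_ℤ : ℕ → CommutativeRing 0ℓ 0ℓ
ℤ/ n ℤ = record { isCommutativeRing = ℤ/-isCommutativeRing n }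

module _ (n : ℕ) where

  open CommutativeRing (ℤ/ n ℤ)
    using (Carrier; _≈_; _+_; _*_; 0#; 1#; *-cong; +-rawMonoid)
    renaming (refl to ≈-refl; sym to ≈-sym; trans to ≈-trans)
  open import Algebra.Definitions _≈_ using (Invertible)
  open import Algebra.Definitions.RawMonoid +-rawMonoid using (sum)

  U : Pred Carrier 0ℓ
  U = Invertible 1# _*_

  U-respects-≈ : U Respects _≈_
  U-respects-≈ x≈y (u , ux≈1 , xu≈1) =
    u , ≈-trans (*-cong (≈-refl {x = u}) (≈-sym x≈y)) ux≈1
      , ≈-trans (*-cong (≈-sym x≈y) (≈-refl {x = u})) xu≈1

  -- Below, a subset A of ℤ/nℤ is a predicate on Carrier that respects _≈_.

  -- The index set I selects a subsequence of x; its length is ∣ I ∣.  Only the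
  -- weights at indices in I matter.
  IsWeightedZeroSum : Pred Carrier 0ℓ → ∀ {l} → Vector Carrier l → Subset l → Set
  IsWeightedZeroSum A {l} x I =
    Nonempty I ×
    (Σ[ a ∈ Vector Carrier l ]
      (∀ i → i ∈ I → A (a i)) ×
      sum (λ i → if lookup I i then a i * x i else 0#) ≈ 0#)

  HasZeroSumOfLength : Pred Carrier 0ℓ → ℕ → ∀ {l} → Vector Carrier l → Set
  HasZeroSumOfLength A m {l} x =
    Σ[ I ∈ Subset l ] ∣ I ∣ ≡ m × IsWeightedZeroSum A x I

  GaoProperty : Pred Carrier 0ℓ → ℕ → Set
  GaoProperty A k = (x : Vector Carrier k) → HasZeroSumOfLength A n x

  -- k = E_A(n)
  IsGaoConstant : Pred Carrier 0ℓ → ℕ → Set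
  IsGaoConstant A k =
    0 ℕ.< k × GaoProperty A k × (∀ j → 0 ℕ.< j → GaoProperty A j → k ℕ.≤ j)

  IsGaoExtremal : Pred Carrier 0ℓ → ∀ {l} → Vector Carrier l → Set
  IsGaoExtremal A {l} x =
    (∃[ k ] IsGaoConstant A k × l ≡ k ℕ.∸ 1) × ¬ HasZeroSumOfLength A n x

  -- The lengths l and m may differ as expressions, but the bijection σ forces
  -- them to be equal.
  Equivalent : Pred Carrier 0ℓ → ∀ {l m} → Vector Carrier l → Vector Carrier m → Set
  Equivalent A {l} {m} x y =
    ∃[ c ] U c ×
    (Σ[ σ ∈ Permutation l m ] Σ[ a ∈ Vector Carrier l ]
      (∀ i → A (a i)) × (∀ i → c * y (σ ⟨$⟩ʳ i) ≈ a i * x i))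

∏ : ∀ {k} → Vector ℕ k → ℕ
∏ = foldr ℕ._*_ 1

partialProducts : ∀ {k} → Vector ℕ k → Vector ℤ k → Vector ℤ k
partialProducts p b i = + ∏ (λ (j : Fin′ i) → p (inject j)) ℤ.* b i

standardSequence : (n : ℕ) → ∀ {k} → Vector ℕ k → Vector ℤ k → Vector ℤ (k ℕ.+ (n ℕ.∸ 1))
standardSequence n p b = partialProducts p b ++ replicate (n ℕ.∸ 1) 0ℤ

module Submission where

-- Let n = p₁ ⋯ pₖ.  If for every pⱼ at least two entries of a sequence y are
-- coprime to pⱼ, then units aᵢ with ∑ aᵢ yᵢ ≡ 0 are found one prime at a time:
-- weights that work modulo M are changed by multiples of M so that they become
-- units modulo p M, and two of the changes also make the sum divisible by p M.
--
-- In a sequence of length at least n + k, either every pⱼ has two such entries,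
-- and 2k ≤ n leaves room for all of them in a subsequence of length n, or for
-- some pⱼ all entries but at most one are divisible by pⱼ; dropping that entry
-- and dividing the others by pⱼ replaces the modulus by n/pⱼ and k by k − 1, with
-- the length n of the subsequence unchanged.  In a sequence of length
-- n + k − 1 without a zero-sum subsequence of length n the first alternative is
-- impossible for k > 0, and in the second exactly one entry is dropped,
-- which is the first entry of the standard sequence.  Conversely, a zero-sum
-- subsequence of a standard sequence cannot use its first entry, the only one not
-- divisible by p₁, so one again divides by p₁.

open import Defs
import Algebra.Properties.CommutativeMonoid.Sum as CommutativeMonoidSum
import Algebra.Properties.Semiring.Sum as SemiringSum
open import Data.Bool.Base using (Bool; true; false; if_then_else_)
open import Data.Fin.Base using (Fin; zero; suc; inject; punchIn; punchOut; splitAt)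
open import Data.Fin.Permutation as Perm using (Permutation; _⟨$⟩ʳ_; _⟨$⟩ˡ_)
open import Data.Fin.Properties using (_≟_; any?; punchInᵢ≢i; punchIn-punchOut)
open import Data.Fin.Subset as Subset using (Subset; Nonempty; _∈_)
open import Data.Fin.Subset.Properties using (nonempty?; Empty-unique; ∣⊥∣≡0)
open import Data.Integer.Base as ℤ using (ℤ; +_; -[1+_]; _+_; _*_; -_; _-_; 0ℤ; 1ℤ)
open import Data.Integer.Coprimality using (Coprime)
open import Data.Integer.Divisibility.Signed
open import Data.Integer.Properties as ℤ using (pos-*; pos-+)
open import Data.Integer.Tactic.RingSolver using (solve-∀)
open import Data.List.Base as List using (List)
open import Data.List.Membership.Propositional.Properties using (∈-lookup)
open import Data.List.Relation.Unary.All as All using (All)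
open import Data.Nat.Base as ℕ using (ℕ; zero; suc; _<_; _≤_; s≤s; z≤n)
import Data.Nat.Coprimality as ℕ
open import Data.Nat.Divisibility as ℕ using (_∤_)
open import Data.Nat.GCD using (module Bézout)
open import Data.Nat.ListAction using (product)
open import Data.Nat.Primality
  using (Prime; euclidsLemma; prime⇒irreducible; prime⇒nonZero; prime⇒nonTrivial)
open import Data.Nat.Primality.Factorisation using (factorise; module PrimeFactorisation)
import Data.Nat.Properties as ℕ
open import Data.Product.Base using (_×_; _,_; ∃-syntax; Σ-syntax; proj₁; proj₂)
open import Data.Sum.Base as Sum using (_⊎_; inj₁; inj₂; [_,_]′)
import Data.Vec.Base as Vec
open import Data.Vec.Functional
  using (Vector; []; _∷_; _++_; tail; replicate; removeAt; insertAt; updateAt)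
open import Data.Vec.Functional.Properties
  using (insertAt-lookup; insertAt-punchIn; updateAt-updates; updateAt-minimal)
open import Data.Vec.Properties using (lookup⇒[]=; lookup∘tabulate)
open import Function.Base using (_∘_; const)
open import Function.Bundles using (_⇔_; mk⇔)
open import Relation.Binary.PropositionalEquality
  using (_≡_; _≢_; refl; sym; trans; cong; cong₂; subst; subst₂; module ≡-Reasoning)
open import Relation.Nullary using (¬_; yes; no; contradiction; ¬?)
open import Relation.Nullary.Decidable using (decidable-stable)

private
  variable
    k l m p M N : ℕ
    a b d x y : ℤ

open SemiringSum ℤ.+-*-semiring
  using (sum; sum-cong-≗; sum-remove; sum-permute; ∑-distrib-+; *-distribˡ-sum; *-distribʳ-sum)
module Count = CommutativeMonoidSum ℕ.+-0-commutativeMonoid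
module Product = CommutativeMonoidSum ℕ.*-1-commutativeMonoid

-- Divisibility and units modulo `N`, over the integers.

≡-∣ : ∀ {k} → x ≡ y → k ∣ x → k ∣ y
≡-∣ refl k∣x = k∣x

-- The inverse is an explicit integer, so one and the same weight can be viewed under several
-- moduli.
Unit : ℕ → ℤ → Set
Unit N a = ∃[ w ] + N ∣ w * a - 1ℤ

unit-1 : Unit N 1ℤ
unit-1 {N} = 1ℤ , divides 0ℤ refl

unit-inverse : ((w , _) : Unit N a) → Unit N w
unit-inverse {N} {a} (w , h) = a , ≡-∣ (cong (_- 1ℤ) (ℤ.*-comm w a)) h

unit-* : Unit N a → Unit N b → Unit N (a * b)
unit-* {N} {a} {b} (w , h) (v , g) = w * v ,
  ≡-∣ (lemma a b w v) (∣m∣n⇒∣m+n (∣m⇒∣m*n (v * b) h) g)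
  where
  lemma : ∀ a b w v → (w * a - 1ℤ) * (v * b) + (v * b - 1ℤ) ≡ w * v * (a * b) - 1ℤ
  lemma = solve-∀

unit-+ : Unit N a → + N ∣ d → Unit N (a + d)
unit-+ {N} {a} {d} (w , h) N∣d = w , ≡-∣ (lemma a d w) (∣m∣n⇒∣m+n h (∣n⇒∣m*n w N∣d))
  where
  lemma : ∀ a d w → w * a - 1ℤ + w * d ≡ w * (a + d) - 1ℤ
  lemma = solve-∀

unit-∣ : + M ∣ + N → Unit N a → Unit M a
unit-∣ M∣N (w , h) = w , ∣-trans M∣N h

∣-*-* : + p ∣ x → + M ∣ y → + (p ℕ.* M) ∣ x * y
∣-*-* {p} {x} {M} {y} (divides q refl) (divides r refl) = divides (q * r) (begin
  q * + p * (r * + M)    ≡⟨ lemma q r (+ p) (+ M) ⟩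
  q * r * (+ p * + M)    ≡⟨ cong (q * r *_) (pos-* p M) ⟨
  q * r * + (p ℕ.* M)    ∎)
  where
  open ≡-Reasoning
  lemma : ∀ q r s t → q * s * (r * t) ≡ q * r * (s * t)
  lemma = solve-∀

m∣m*n : ∀ m n → + m ∣ + (m ℕ.* n)
m∣m*n m n = ∣ᵤ⇒∣ (ℕ.m∣m*n n)

n∣m*n : ∀ m n → + n ∣ + (m ℕ.* n)
n∣m*n m n = ∣ᵤ⇒∣ (ℕ.n∣m*n m)

-- (w a − 1)(v a − 1) = 1 − (w + v − w v a) a.
unit-product : Unit p a → Unit M a → Unit (p ℕ.* M) a
unit-product {a = a} (w , h) (v , g) =
  w + v - w * v * a , ≡-∣ (lemma a w v) (∣m⇒∣-m (∣-*-* h g))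
  where
  lemma : ∀ a w v → - ((w * a - 1ℤ) * (v * a - 1ℤ)) ≡ (w + v - w * v * a) * a - 1ℤ
  lemma = solve-∀

-- Bézout identities over the naturals come in two sign patterns; for a negative `x` the inverse of
-- its absolute value is negated.
coprime⇒unit : ∀ x → Coprime x (+ p) → Unit p x
coprime⇒unit {p} (+ n) c with ℕ.coprime-Bézout c
... | Bézout.+- s t eq = + s , divides (+ t) (begin
  + s * + n - 1ℤ             ≡⟨ cong (_- 1ℤ) (pos-* s n) ⟨
  + (s ℕ.* n) - 1ℤ           ≡⟨ cong (λ z → + z - 1ℤ) eq ⟨
  + (1 ℕ.+ t ℕ.* p) - 1ℤ     ≡⟨ cong (_- 1ℤ) (pos-+ 1 (t ℕ.* p)) ⟩
  1ℤ + + (t ℕ.* p) - 1ℤ      ≡⟨ lemma (+ (t ℕ.* p)) ⟩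
  + (t ℕ.* p)                ≡⟨ pos-* t p ⟩
  + t * + p                  ∎)
  where
  open ≡-Reasoning
  lemma : ∀ z → 1ℤ + z - 1ℤ ≡ z
  lemma = solve-∀
... | Bézout.-+ s t eq = - (+ s) , divides (- (+ t)) (begin
  - (+ s) * + n - 1ℤ         ≡⟨ lemma (+ s) (+ n) ⟩
  - (1ℤ + + s * + n)         ≡⟨ cong (λ z → - (1ℤ + z)) (pos-* s n) ⟨
  - (1ℤ + + (s ℕ.* n))       ≡⟨ cong -_ (pos-+ 1 (s ℕ.* n)) ⟨
  - (+ (1 ℕ.+ s ℕ.* n))      ≡⟨ cong (λ z → - (+ z)) eq ⟩
  - (+ (t ℕ.* p))            ≡⟨ cong -_ (pos-* t p) ⟩
  - (+ t * + p)              ≡⟨ ℤ.neg-distribˡ-* (+ t) (+ p) ⟩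
  - (+ t) * + p              ∎)
  where
  open ≡-Reasoning
  lemma : ∀ s z → - s * z - 1ℤ ≡ - (1ℤ + s * z)
  lemma = solve-∀
coprime⇒unit -[1+ n ] c with coprime⇒unit (+ suc n) c
... | w , h = - w , ≡-∣ (lemma w (+ suc n)) h
  where
  lemma : ∀ w z → w * z - 1ℤ ≡ - w * - z - 1ℤ
  lemma = solve-∀

∤⇒coprime : Prime p → ¬ + p ∣ x → Coprime x (+ p)
∤⇒coprime pr p∤x (e∣x , e∣p) with prime⇒irreducible pr e∣p
... | inj₁ e≡1  = e≡1
... | inj₂ refl = contradiction (∣ᵤ⇒∣ e∣x) p∤x

∤⇒unit : Prime p → ¬ + p ∣ x → Unit p x
∤⇒unit {x = x} pr p∤x = coprime⇒unit x (∤⇒coprime pr p∤x)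

∤-< : ∀ {n} .{{_ : ℕ.NonZero n}} → n < p → ¬ + p ∣ + n
∤-< n<p p∣n = ℕ.>⇒∤ n<p (∣⇒∣ᵤ p∣n)

prime∤1 : Prime p → ¬ + p ∣ 1ℤ
prime∤1 {p} pr = ∤-< (ℕ.nonTrivial⇒n>1 p {{prime⇒nonTrivial pr}})

unit⇒∤ : Prime p → Unit p x → ¬ + p ∣ x
unit⇒∤ {x = x} pr (w , h) p∣x =
  prime∤1 pr (≡-∣ (lemma (w * x)) (∣m∣n⇒∣m-n (∣n⇒∣m*n w p∣x) h))
  where
  lemma : ∀ z → z - (z - 1ℤ) ≡ 1ℤ
  lemma = solve-∀

euclid : Prime p → + p ∣ x * y → + p ∣ x ⊎ + p ∣ y
euclid {x = x} {y = y} pr h =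
  Sum.map ∣ᵤ⇒∣ ∣ᵤ⇒∣ (euclidsLemma ℤ.∣ x ∣ ℤ.∣ y ∣ pr (subst (_ ℕ.∣_) (ℤ.abs-* x y) (∣⇒∣ᵤ h)))

-- If `p` divides `a`, then it cannot divide `M`, because `a` is invertible modulo `M`; adding `M`
-- once therefore leaves the multiples of `p`.
unit-lift : Prime p → Unit M a → ∃[ e ] ¬ + p ∣ a + + M * e
unit-lift {p} {M} {a} pr ua with + p ∣? a
... | no p∤a = 0ℤ , λ h → p∤a (≡-∣ (lemma a (+ M)) h)
  where
  lemma : ∀ a m → a + m * 0ℤ ≡ a
  lemma = solve-∀
... | yes p∣a = 1ℤ , λ h →
  unit⇒∤ pr (unit-∣ (≡-∣ (ℤ.*-identityʳ (+ M)) (∣m+n∣m⇒∣n h p∣a)) ua) p∣a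

unit-lift⇒unit : ∀ {e} → Prime p → Unit M a → ¬ + p ∣ a + + M * e → Unit (p ℕ.* M) (a + + M * e)
unit-lift⇒unit {e = e} pr ua h =
  unit-product (∤⇒unit pr h) (unit-+ ua (∣m⇒∣m*n e ∣-refl))

-- Correcting two weights modulo an odd prime.

OddPrime : ℕ → Set
OddPrime p = Prime p × 2 < p

-- p ∤ β forces p ∤ M whenever p ∣ β + M * _ .
affine-root-unique : ∀ {β} m c {r} z z′ → Prime p → ¬ + p ∣ β → ¬ + p ∣ r →
  + p ∣ β + m * (c + r * z) → + p ∣ β + m * (c + r * z′) → + p ∣ z - z′
affine-root-unique {β = β} m c {r} z z′ pr p∤β p∤r h h′
  with euclid {x = m} pr (≡-∣ (lemma β m c r z z′) (∣m∣n⇒∣m-n h h′))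
  where
  lemma : ∀ β m c r z z′ → (β + m * (c + r * z)) - (β + m * (c + r * z′)) ≡ m * (r * (z - z′))
  lemma = solve-∀
... | inj₁ p∣m = contradiction (∣m+n∣n⇒∣m h (∣m⇒∣m*n _ p∣m)) p∤β
... | inj₂ h″ with euclid {x = r} pr h″
...   | inj₁ p∣r = contradiction p∣r p∤r
...   | inj₂ p∣z = p∣z

-- The second congruence determines z′ from z, and each nondivisibility excludes
-- at most one residue of z, so one of z = 0, 1, 2 works.
adjust : ∀ m s {α β g h} → OddPrime p →
  ¬ + p ∣ α → ¬ + p ∣ β → ¬ + p ∣ g → ¬ + p ∣ h →
  ∃[ z ] ∃[ z′ ] ¬ + p ∣ α + m * z × ¬ + p ∣ β + m * z′ × + p ∣ s + z * g + z′ * h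
adjust {p} m s {α} {β} {g} {h} (pr , 2<p) p∤α p∤β p∤g p∤h = choose
  where
  w : ℤ
  w = proj₁ (∤⇒unit pr p∤h)

  wh≡1 : + p ∣ w * h - 1ℤ
  wh≡1 = proj₂ (∤⇒unit pr p∤h)

  p∤r : ¬ + p ∣ - (g * w)
  p∤r k with euclid {x = g} pr (≡-∣ (ℤ.neg-involutive (g * w)) (∣m⇒∣-m k))
  ... | inj₁ p∣g = p∤g p∣g
  ... | inj₂ p∣w = unit⇒∤ pr (unit-inverse {a = h} (w , wh≡1)) p∣w

  -- Since `w` inverts `h` modulo `p`, this is s + z g + z′ h ≡ 0 solved for z′.
  f : ℤ → ℤ
  f z = - (s * w) + - (g * w) * z

  Bad : ℤ → Set
  Bad z = + p ∣ β + m * f z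

  solves : ∀ z → + p ∣ s + z * g + f z * h
  solves z = ≡-∣ (lemma s g w h z) (∣n⇒∣m*n (- (s + z * g)) wh≡1)
    where
    lemma : ∀ s g w h z →
      - (s + z * g) * (w * h - 1ℤ) ≡ s + z * g + (- (s * w) + - (g * w) * z) * h
    lemma = solve-∀

  good : ∀ {z} → ¬ + p ∣ z - 0ℤ → Bad 0ℤ → ¬ Bad z
  good {z} p∤z b₀ b = p∤z (affine-root-unique m (- (s * w)) z 0ℤ pr p∤β p∤r b b₀)

  -- Oddness enters here: 0 and 2 have to be different residues.
  p∤2 : ¬ + p ∣ + 2
  p∤2 = ∤-< 2<p

  choose : ∃[ z ] ∃[ z′ ] ¬ + p ∣ α + m * z × ¬ + p ∣ β + m * z′ × + p ∣ s + z * g + z′ * h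
  choose with + p ∣? β + m * f 0ℤ
  ... | no ok = 0ℤ , f 0ℤ , (λ k → p∤α (≡-∣ (lemma α m) k)) , ok , solves 0ℤ
    where
    lemma : ∀ α m → α + m * 0ℤ ≡ α
    lemma = solve-∀
  ... | yes b₀ with + p ∣? α + m * 1ℤ
  ...   | no ok = 1ℤ , f 1ℤ , ok , good (prime∤1 pr) b₀ , solves 1ℤ
  ...   | yes b₁ = + 2 , f (+ 2) , ok , good p∤2 b₀ , solves (+ 2)
    where
    lemma : ∀ m z → α + m * z ≡ α + m * (0ℤ + 1ℤ * z)
    lemma m z = cong (λ t → α + m * t) (sym (trans (ℤ.+-identityˡ _) (ℤ.*-identityˡ z)))
    ok : ¬ + p ∣ α + m * + 2
    ok b₂ = prime∤1 pr (affine-root-unique m 0ℤ (+ 2) 1ℤ pr p∤α (prime∤1 pr)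
      (≡-∣ (lemma m (+ 2)) b₂) (≡-∣ (lemma m 1ℤ) b₁))

-- Weighted sums and index sets.

dot : Vector ℤ l → Vector ℤ l → ℤ
dot a y = sum (λ i → a i * y i)

∣-sum : ∀ {d} (f : Vector ℤ l) → (∀ i → d ∣ f i) → d ∣ sum f
∣-sum {zero}  f h = divides 0ℤ refl
∣-sum {suc l} f h = ∣m∣n⇒∣m+n (h zero) (∣-sum (tail f) (h ∘ suc))

∣-sum-cong : ∀ {d} (f g : Vector ℤ l) → (∀ i → d ∣ f i - g i) → d ∣ sum f → d ∣ sum g
∣-sum-cong {l} {d} f g h d∣f = ∣m+n∣m⇒∣n (≡-∣ eq d∣f) (∣-sum _ h)
  where
  lemma : ∀ x y → x ≡ x - y + y
  lemma = solve-∀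
  eq : sum f ≡ sum (λ i → f i - g i) + sum g
  eq = trans (sum-cong-≗ (λ i → lemma (f i) (g i))) (∑-distrib-+ (λ i → f i - g i) g)

dot-+-*ˡ : ∀ c (a e y : Vector ℤ l) → dot (λ i → a i + c * e i) y ≡ dot a y + c * dot e y
dot-+-*ˡ c a e y = begin
  dot (λ i → a i + c * e i) y
    ≡⟨ sum-cong-≗ (λ i → lemma (a i) c (e i) (y i)) ⟩
  sum (λ i → a i * y i + c * (e i * y i))
    ≡⟨ ∑-distrib-+ (λ i → a i * y i) (λ i → c * (e i * y i)) ⟩
  dot a y + sum (λ i → c * (e i * y i))
    ≡⟨ cong (λ z → dot a y + z) (*-distribˡ-sum c (λ i → e i * y i)) ⟨
  dot a y + c * dot e y ∎
  where
  open ≡-Reasoning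
  lemma : ∀ a c e y → (a + c * e) * y ≡ a * y + c * (e * y)
  lemma = solve-∀

dot-updateAt : ∀ (a y : Vector ℤ l) u d → dot (updateAt a u (_+ d)) y ≡ dot a y + d * y u
dot-updateAt a y zero d = lemma (a zero) d (y zero) (dot (tail a) (tail y))
  where
  lemma : ∀ a d y s → (a + d) * y + s ≡ a * y + s + d * y
  lemma = solve-∀
dot-updateAt a y (suc u) d = trans
  (cong (λ s → a zero * y zero + s) (dot-updateAt (tail a) (tail y) u d))
  (sym (ℤ.+-assoc (a zero * y zero) _ _))

-- A subsequence keeps the full length, with zeros outside `I`, so that weights and sums are never
-- reindexed.
mask : Vector Bool l → Vector ℤ l → Vector ℤ l
mask I x i = if I i then x i else 0ℤ

if-* : ∀ b x y → (if b then x * y else 0ℤ) ≡ x * (if b then y else 0ℤ)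
if-* true  x y = refl
if-* false x y = sym (ℤ.*-zeroʳ x)

count : Vector Bool l → ℕ
count I = Count.sum (λ i → if I i then 1 else 0)

count≤l : (I : Vector Bool l) → count I ≤ l
count≤l {zero}  I = z≤n
count≤l {suc l} I with I zero
... | true  = s≤s (count≤l (tail I))
... | false = ℕ.m≤n⇒m≤1+n (count≤l (tail I))

count-updateAt : ∀ (I : Vector Bool l) u → count (updateAt I u (const true)) ≤ suc (count I)
count-updateAt I zero = s≤s (ℕ.m≤n+m _ _)
count-updateAt I (suc u) = ℕ.≤-trans
  (ℕ.+-monoʳ-≤ c (count-updateAt (tail I) u)) (ℕ.≤-reflexive (ℕ.+-suc c _))
  where
  c = if I zero then 1 else 0

updateAt-true : ∀ (I : Vector Bool l) u {i} → I i ≡ true → updateAt I u (const true) i ≡ true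
updateAt-true I u {i} Ii with i ≟ u
... | yes refl = updateAt-updates i I
... | no  i≢u  = trans (updateAt-minimal i u I i≢u) Ii

-- `u j` and `v j` will be two positions whose entries are prime to the `j`-th prime; each prime
-- adds at most two indices.
cover : (u v : Vector (Fin l) k) →
  Σ[ J ∈ Vector Bool l ] count J ≤ 2 ℕ.* k × (∀ j → J (u j) ≡ true × J (v j) ≡ true)
cover {l} {zero} u v = const false , ℕ.≤-reflexive (none l) , λ ()
  where
  none : ∀ l → count {l} (const false) ≡ 0
  none zero    = refl
  none (suc l) = none l
cover {l} {suc k} u v with cover (tail u) (tail v)
... | J , J≤ , h = J₂ , size , λ where
    zero    → updateAt-true J₁ (v zero) (updateAt-updates (u zero) J) , updateAt-updates (v zero) J₁
    (suc j) → keep (proj₁ (h j)) , keep (proj₂ (h j))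
  where
  J₁ = updateAt J (u zero) (const true)
  J₂ = updateAt J₁ (v zero) (const true)
  keep : ∀ {i} → J i ≡ true → J₂ i ≡ true
  keep = updateAt-true J₁ (v zero) ∘ updateAt-true J (u zero)
  size : count J₂ ≤ 2 ℕ.* suc k
  size = begin
    count J₂                ≤⟨ count-updateAt J₁ (v zero) ⟩
    suc (count J₁)          ≤⟨ s≤s (count-updateAt J (u zero)) ⟩
    2 ℕ.+ count J           ≤⟨ ℕ.+-monoʳ-≤ 2 J≤ ⟩
    2 ℕ.+ 2 ℕ.* k           ≡⟨ ℕ.*-suc 2 k ⟨
    2 ℕ.* suc k             ∎
    where open ℕ.≤-Reasoning

-- Greedy: indices are put in from the left until the rest of `J` has exactly as many elements as
-- are still wanted; that rest is then kept unchanged.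
enlarge : (J : Vector Bool l) → count J ≤ m → m ≤ l →
  Σ[ I ∈ Vector Bool l ] count I ≡ m × (∀ i → J i ≡ true → I i ≡ true)
enlarge {zero} J J≤ z≤n = J , refl , λ _ Ji → Ji
enlarge {suc l} {m} J J≤ m≤l with count J ℕ.≟ m
... | yes eq = J , eq , λ _ Ji → Ji
... | no ≢m with m | ℕ.≤∧≢⇒< J≤ ≢m | m≤l
...   | suc m′ | s≤s J≤m′ | s≤s m′≤l
      with enlarge (tail J) (ℕ.≤-trans (ℕ.m≤n+m _ _) J≤m′) m′≤l
...     | I , I≡ , J⊆I = true ∷ I , cong suc I≡ , λ where
  zero    _  → refl
  (suc i) Ji → J⊆I i Ji

-- Zero-sum subsequences when an entry is added or all entries are multiplied by a prime.

-- Compared with HasZeroSumOfLength, the weights outside I are units as well.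
ZeroSum : ℕ → ℕ → Vector ℤ l → Set
ZeroSum {l} N m x =
  Σ[ I ∈ Vector Bool l ] count I ≡ m ×
  (Σ[ a ∈ Vector ℤ l ] (∀ i → Unit N (a i)) × + N ∣ dot a (mask I x))

zeroSum-removeAt : ∀ (x : Vector ℤ (suc l)) i → ZeroSum N m (removeAt x i) → ZeroSum N m x
zeroSum-removeAt {l} {N} {m} x i (I′ , I′≡ , a′ , ua′ , h) = I⁺ , I≡ , a⁺ , ua , ≡-∣ (sym dot≡) h
  where
  I⁺ = insertAt I′ i false
  -- The weight 1 is a placeholder: `i` lies outside `I⁺`.
  a⁺ = insertAt a′ i 1ℤ
  I-i = insertAt-lookup I′ i false
  I-p = insertAt-punchIn I′ i false
  I≡ : count I⁺ ≡ m
  I≡ = begin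
    count I⁺
      ≡⟨ Count.sum-remove {i = i} (λ j → if I⁺ j then 1 else 0) ⟩
    (if I⁺ i then 1 else 0) ℕ.+ count (removeAt I⁺ i)
      ≡⟨ cong₂ ℕ._+_ (cong (if_then 1 else 0) I-i)
           (Count.sum-cong-≗ (λ j → cong (if_then 1 else 0) (I-p j))) ⟩
    count I′
      ≡⟨ I′≡ ⟩
    m ∎
    where open ≡-Reasoning
  ua : ∀ j → Unit N (a⁺ j)
  ua j with i ≟ j
  ... | yes refl = subst (Unit N) (sym (insertAt-lookup a′ i 1ℤ)) unit-1
  ... | no i≢j = subst (Unit N)
    (trans (sym (insertAt-punchIn a′ i 1ℤ _)) (cong a⁺ (punchIn-punchOut i≢j))) (ua′ (punchOut i≢j))
  dot≡ : dot a⁺ (mask I⁺ x) ≡ dot a′ (mask I′ (removeAt x i))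
  dot≡ = begin
    dot a⁺ (mask I⁺ x)
      ≡⟨ sum-remove {i = i} (λ j → a⁺ j * mask I⁺ x j) ⟩
    a⁺ i * mask I⁺ x i + dot (removeAt a⁺ i) (removeAt (mask I⁺ x) i)
      ≡⟨ cong₂ _+_
           (trans (cong (λ b → a⁺ i * (if b then x i else 0ℤ)) I-i) (ℤ.*-zeroʳ (a⁺ i)))
           (sum-cong-≗ (λ j → cong₂ (λ c b → c * (if b then x (punchIn i j) else 0ℤ))
             (insertAt-punchIn a′ i 1ℤ j) (I-p j))) ⟩
    0ℤ + dot a′ (mask I′ (removeAt x i))
      ≡⟨ ℤ.+-identityˡ _ ⟩
    dot a′ (mask I′ (removeAt x i)) ∎
    where open ≡-Reasoning

mask-*ʳ : ∀ {c} (I : Vector Bool l) (x t : Vector ℤ l) → (∀ i → x i ≡ t i * c) →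
  ∀ i → mask I x i ≡ mask I t i * c
mask-*ʳ {c = c} I x t eq i with I i
... | true  = eq i
... | false = sym (ℤ.*-zeroˡ c)

dot-mask-*ʳ : ∀ {c} (a : Vector ℤ l) I x t → (∀ i → x i ≡ t i * c) →
  dot a (mask I x) ≡ dot a (mask I t) * c
dot-mask-*ʳ {c = c} a I x t eq = trans
  (sum-cong-≗ (λ i → trans (cong (a i *_) (mask-*ʳ I x t eq i)) (sym (ℤ.*-assoc (a i) _ c))))
  (sym (*-distribʳ-sum c (λ i → a i * mask I t i)))

-- Making the weights units modulo `p M` changes the sum over `t` by a multiple of `M`. It stays
-- divisible by `M`, and the factor `p` of the entries of `x` supplies the rest.
zeroSum-* : Prime p → {x t : Vector ℤ l} → (∀ i → x i ≡ t i * + p) →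
  ZeroSum M m t → ZeroSum (p ℕ.* M) m x
zeroSum-* {p} {l} {M} pr {x} {t} x≡tp (I , I≡ , a , ua , h) =
  I , I≡ , a′ , (λ i → unit-lift⇒unit {e = e i} pr (ua i) (proj₂ (unit-lift pr (ua i)))) ,
  ≡-∣ eq (∣-*-* (∣-refl {+ p}) (∣m∣n⇒∣m+n h (∣m⇒∣m*n (dot e (mask I t)) ∣-refl)))
  where
  e a′ : Vector ℤ l
  e i = proj₁ (unit-lift pr (ua i))
  a′ i = a i + + M * e i
  eq : + p * (dot a (mask I t) + + M * dot e (mask I t)) ≡ dot a′ (mask I x)
  eq = begin
    + p * (dot a (mask I t) + + M * dot e (mask I t))  ≡⟨ ℤ.*-comm (+ p) _ ⟩
    (dot a (mask I t) + + M * dot e (mask I t)) * + p  ≡⟨ cong (_* + p) (dot-+-*ˡ (+ M) a e (mask I t)) ⟨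
    dot a′ (mask I t) * + p                            ≡⟨ dot-mask-*ʳ a′ I x t x≡tp ⟨
    dot a′ (mask I x)                                  ∎
    where open ≡-Reasoning

zeroSum-quotient : Prime p → {x : Vector ℤ l} (h : ∀ i → + p ∣ x i) →
  ZeroSum M m (quotient ∘ h) → ZeroSum (p ℕ.* M) m x
zeroSum-quotient pr {x} h = zeroSum-* pr {x} {quotient ∘ h} (_∣_.equality ∘ h)

-- Entries prime to `p`, and weights built prime by prime.

Two : ℕ → Vector ℤ l → Set
Two p x = ∃[ u ] ∃[ v ] u ≢ v × ¬ + p ∣ x u × ¬ + p ∣ x v

-- An indexed family, so that matching on `one` turns the length into a successor and the
-- exceptional entry can be removed.
data AtMostOne (p : ℕ) : ∀ {l} → Vector ℤ l → Set where
  none : {x : Vector ℤ l} → (∀ i → + p ∣ x i) → AtMostOne p x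
  one  : {x : Vector ℤ (suc l)} → ∀ i → ¬ + p ∣ x i → (∀ j → + p ∣ removeAt x i j) → AtMostOne p x

two⊎atMostOne : ∀ p (x : Vector ℤ l) → Two p x ⊎ AtMostOne p x
two⊎atMostOne {zero} p x = inj₂ (none λ ())
two⊎atMostOne {suc l} p x with any? (λ i → ¬? (+ p ∣? x i))
... | no ∄ = inj₂ (none λ i → decidable-stable (+ p ∣? x i) (λ h → ∄ (i , h)))
... | yes (u , hu) with any? (λ j → ¬? (+ p ∣? removeAt x u j))
...   | yes (j , hj) = inj₁ (u , punchIn u j , punchInᵢ≢i u j ∘ sym , hu , hj)
...   | no ∄ = inj₂ (one u hu λ j → decidable-stable (+ p ∣? removeAt x u j) (λ h → ∄ (j , h)))

∀⊎∃ : {P Q : Fin k → Set} → (∀ j → P j ⊎ Q j) → (∀ j → P j) ⊎ (∃[ j ] Q j)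
∀⊎∃ {zero} f = inj₁ λ ()
∀⊎∃ {suc k} f with f zero | ∀⊎∃ (f ∘ suc)
... | inj₂ q | _            = inj₂ (zero , q)
... | inj₁ _ | inj₂ (j , q) = inj₂ (suc j , q)
... | inj₁ p | inj₁ ps      = inj₁ λ { zero → p ; (suc j) → ps j }

-- Shifting the weights at `u` and `v` by `M z` and `M z′` keeps them units modulo `M` and changes
-- the sum divided by `M` from `s` to `s + z * y u + z′ * y v`, which `adjust` makes divisible by
-- `p`.
weights-adjust : OddPrime p → (a y : Vector ℤ l) → (∀ i → ¬ + p ∣ a i) → (∀ i → Unit M (a i)) →
  + M ∣ dot a y → Two p y →
  Σ[ a′ ∈ Vector ℤ l ] (∀ i → Unit (p ℕ.* M) (a′ i)) × + (p ℕ.* M) ∣ dot a′ y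
weights-adjust {p} {l} {M} op@(pr , _) a y p∤a ua (divides s eq) (u , v , u≢v , p∤yu , p∤yv)
  with adjust (+ M) s op (p∤a u) (p∤a v) p∤yu p∤yv
... | z , z′ , p∤u , p∤v , p∣s =
  a″ , (λ i → unit-product (∤⇒unit pr (p∤a″ i)) (ua″ i)) , total
  where
  a′ a″ : Vector ℤ l
  a′ = updateAt a u (_+ + M * z)
  a″ = updateAt a′ v (_+ + M * z′)

  -- A property of all new weights is checked on the old ones and on the two changed values; `u ≢ v`
  -- guarantees that the second change starts from `a v`.
  updates : (P : ℤ → Set) → (∀ i → P (a i)) → P (a u + + M * z) → P (a v + + M * z′) →
    ∀ i → P (a″ i)
  updates P h hu hv i with i ≟ v
  ... | yes refl = subst P (sym (trans (updateAt-updates v a′)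
      (cong (_+ + M * z′) (updateAt-minimal v u a (u≢v ∘ sym))))) hv
  ... | no i≢v = subst P (sym (updateAt-minimal i v a′ i≢v)) a′-i
    where
    a′-i : P (a′ i)
    a′-i with i ≟ u
    ... | yes refl = subst P (sym (updateAt-updates u a)) hu
    ... | no i≢u   = subst P (sym (updateAt-minimal i u a i≢u)) (h i)

  p∤a″ : ∀ i → ¬ + p ∣ a″ i
  p∤a″ = updates (λ c → ¬ + p ∣ c) p∤a p∤u p∤v

  ua″ : ∀ i → Unit M (a″ i)
  ua″ = updates (Unit M) ua (unit-+ (ua u) (∣m⇒∣m*n z ∣-refl)) (unit-+ (ua v) (∣m⇒∣m*n z′ ∣-refl))

  lemma : ∀ s m z z′ g h → (s + z * g + z′ * h) * m ≡ s * m + m * z * g + m * z′ * h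
  lemma = solve-∀

  total : + (p ℕ.* M) ∣ dot a″ y
  total = ≡-∣ (begin
    (s + z * y u + z′ * y v) * + M
      ≡⟨ lemma s (+ M) z z′ (y u) (y v) ⟩
    s * + M + + M * z * y u + + M * z′ * y v
      ≡⟨ cong (λ t → t + + M * z * y u + + M * z′ * y v) eq ⟨
    dot a y + + M * z * y u + + M * z′ * y v
      ≡⟨ cong (_+ + M * z′ * y v) (dot-updateAt a y u (+ M * z)) ⟨
    dot a′ y + + M * z′ * y v
      ≡⟨ dot-updateAt a′ y v (+ M * z′) ⟨
    dot a″ y ∎) (∣-*-* p∣s (∣-refl {+ M}))
    where open ≡-Reasoning

-- First every weight is moved off the multiples of `p` by a multiple of `M`, which keeps the sum
-- divisible by `M`; then `weights-adjust` applies.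
weights-step : OddPrime p → (a y : Vector ℤ l) → (∀ i → Unit M (a i)) → + M ∣ dot a y → Two p y →
  Σ[ a′ ∈ Vector ℤ l ] (∀ i → Unit (p ℕ.* M) (a′ i)) × + (p ℕ.* M) ∣ dot a′ y
weights-step {p} {l} {M} op@(pr , _) a y ua M∣ = weights-adjust op (λ i → a i + + M * e i) y
  (λ i → proj₂ (unit-lift pr (ua i)))
  (λ i → unit-+ (ua i) (∣m⇒∣m*n (e i) ∣-refl))
  (≡-∣ (sym (dot-+-*ˡ (+ M) a e y)) (∣m∣n⇒∣m+n M∣ (∣m⇒∣m*n (dot e y) ∣-refl)))
  where
  e : Vector ℤ l
  e i = proj₁ (unit-lift pr (ua i))

-- Primes may repeat in `p`: the step from `M` to `p M` covers the case that `p` already divides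
-- `M`.
weights : (p : Vector ℕ k) → (∀ j → OddPrime (p j)) → (y : Vector ℤ l) → (∀ j → Two (p j) y) →
  Σ[ a ∈ Vector ℤ l ] (∀ i → Unit (∏ p) (a i)) × + ∏ p ∣ dot a y
weights {zero} p op y two =
  const 1ℤ , (λ _ → unit-1) , divides (dot (const 1ℤ) y) (sym (ℤ.*-identityʳ _))
weights {suc k} p op y two with weights (tail p) (op ∘ suc) y (two ∘ suc)
... | a , ua , h = weights-step (op zero) a y ua h (two zero)

-- Existence of zero-sum subsequences of length `m`.

two-mask : ∀ {I : Vector Bool l} {x} ((u , v , _) : Two p x) →
  I u ≡ true → I v ≡ true → Two p (mask I x)
two-mask {p = p} {I} {x} (u , v , u≢v , hu , hv) Iu Iv = u , v , u≢v , hu ∘ at Iu , hv ∘ at Iv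
  where
  at : ∀ {i} → I i ≡ true → + p ∣ mask I x i → + p ∣ x i
  at {i} Ii = ≡-∣ (cong (if_then x i else 0ℤ) Ii)

zeroSum-two : (p : Vector ℕ k) → (∀ j → OddPrime (p j)) → 2 ℕ.* k ≤ m → m ≤ l →
  (x : Vector ℤ l) → (∀ j → Two (p j) x) → ZeroSum (∏ p) m x
zeroSum-two p op 2k≤m m≤l x two
  with cover (λ j → proj₁ (two j)) (λ j → proj₁ (proj₂ (two j)))
... | J , J≤ , h with enlarge J (ℕ.≤-trans J≤ 2k≤m) m≤l
...   | I , I≡ , J⊆I = I , I≡ ,
  weights p op (mask I x) (λ j → two-mask (two j) (J⊆I _ (proj₁ (h j))) (J⊆I _ (proj₂ (h j))))

-- Dividing by a prime lowers `k` by one and the number of entries by at most one, so `k + m ≤ l` is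
-- preserved with the same `m`.
zeroSum-exists : (p : Vector ℕ k) → (∀ j → OddPrime (p j)) → 2 ℕ.* k ≤ m → k ℕ.+ m ≤ l →
  (x : Vector ℤ l) → ZeroSum (∏ p) m x
zeroSum-exists {k} {m} p op 2k≤m k+m≤l x with ∀⊎∃ (λ j → two⊎atMostOne (p j) x)
... | inj₁ two = zeroSum-two p op 2k≤m (ℕ.≤-trans (ℕ.m≤n+m _ k) k+m≤l) x two
-- The index `j` of a prime forces `k` to be a successor.
zeroSum-exists {suc k} {m} p op 2k≤m k+m≤l x | inj₂ (j , few) =
  subst (λ N → ZeroSum N m x) (sym (Product.sum-remove {i = j} p)) (reduce k+m≤l few)
  where
  2k≤m′ : 2 ℕ.* k ≤ m
  2k≤m′ = ℕ.≤-trans (ℕ.*-monoʳ-≤ 2 (ℕ.n≤1+n k)) 2k≤m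
  reduce : ∀ {l} {x : Vector ℤ l} → suc k ℕ.+ m ≤ l → AtMostOne (p j) x →
    ZeroSum (p j ℕ.* ∏ (removeAt p j)) m x
  reduce k+m<l (none h) = zeroSum-quotient (proj₁ (op j)) h
    (zeroSum-exists (removeAt p j) (op ∘ punchIn j) 2k≤m′ (ℕ.<⇒≤ k+m<l) (quotient ∘ h))
  reduce {x = x} (s≤s k+m≤l) (one i _ h) =
    zeroSum-removeAt x i (zeroSum-quotient (proj₁ (op j)) h
      (zeroSum-exists (removeAt p j) (op ∘ punchIn j) 2k≤m′ k+m≤l (quotient ∘ h)))

-- Standard sequences have no zero-sum subsequence of length `suc m`.

-- standardSequence with the number of zeros as parameter, so that the modulus can
-- be divided by primes while the zeros stay.
standard : ∀ m → Vector ℕ k → Vector ℤ k → Vector ℤ (k ℕ.+ m)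
standard m p b = partialProducts p b ++ replicate m 0ℤ

-- This self-similarity drives the inductions of both directions.
standard-suc : ∀ m (p : Vector ℕ (suc k)) b i →
  standard m p b (suc i) ≡ standard m (tail p) (tail b) i * + p zero
standard-suc {k} m p b i with splitAt k i
... | inj₁ j = begin
  + (p zero ℕ.* P) * b (suc j)    ≡⟨ cong (_* b (suc j)) (pos-* (p zero) P) ⟩
  + p zero * + P * b (suc j)      ≡⟨ lemma (+ p zero) (+ P) (b (suc j)) ⟩
  + P * b (suc j) * + p zero      ∎
  where
  open ≡-Reasoning
  P = ∏ (λ i → p (suc (inject {i = j} i)))
  lemma : ∀ x y z → x * y * z ≡ y * z * x
  lemma = solve-∀
... | inj₂ _ = refl

-- Modulo `p` only the first entry can contribute, and a unit times it is not 0. Hence index `zero`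
-- is not selected, and the remaining sum can be divided by `p`.
zeroSum-tail : ∀ (x : Vector ℤ (suc l)) t → Prime p →
  (∀ i → x (suc i) ≡ t i * + p) → ¬ + p ∣ x zero →
  ZeroSum (p ℕ.* M) m x → ZeroSum M m t
zeroSum-tail {l} {p} {M} {m} x t pr eq p∤x₀ (I , I≡ , a , ua , h) = go (I zero) refl
  where
  rest : ℤ
  rest = dot (tail a) (mask (tail I) (tail x))

  rest≡ : rest ≡ dot (tail a) (mask (tail I) t) * + p
  rest≡ = dot-mask-*ʳ (tail a) (tail I) (tail x) t eq

  dot≡ : ∀ {b} → I zero ≡ b →
    dot a (mask I x) ≡ a zero * (if b then x zero else 0ℤ) + rest
  dot≡ = cong (λ b → a zero * (if b then x zero else 0ℤ) + rest)

  go : ∀ b → I zero ≡ b → ZeroSum M m t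
  go true I₀ = contradiction p∣ax₀ λ h′ →
    [ unit⇒∤ pr (unit-∣ (m∣m*n p M) (ua zero)) , p∤x₀ ]′ (euclid {x = a zero} pr h′)
    where
    p∣ax₀ : + p ∣ a zero * x zero
    p∣ax₀ = ∣m+n∣n⇒∣m
      (≡-∣ (dot≡ I₀) (∣-trans (m∣m*n p M) h))
      (≡-∣ (sym rest≡) (∣n⇒∣m*n (dot (tail a) (mask (tail I) t)) ∣-refl))
  go false I₀ =
    tail I , trans (cong (λ b → (if b then 1 else 0) ℕ.+ count (tail I)) (sym I₀)) I≡ ,
    tail a , (λ i → unit-∣ (n∣m*n p M) (ua (suc i))) ,
    *-cancelʳ-∣ (+ p) {{prime⇒nonZero pr}}
      (subst₂ _∣_ (trans (pos-* p M) (ℤ.*-comm (+ p) (+ M))) dot≡rest h)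
    where
    open ≡-Reasoning
    dot≡rest : dot a (mask I x) ≡ dot (tail a) (mask (tail I) t) * + p
    dot≡rest = begin
      dot a (mask I x)                        ≡⟨ dot≡ I₀ ⟩
      a zero * 0ℤ + rest                      ≡⟨ cong (_+ rest) (ℤ.*-zeroʳ (a zero)) ⟩
      0ℤ + rest                               ≡⟨ ℤ.+-identityˡ rest ⟩
      rest                                    ≡⟨ rest≡ ⟩
      dot (tail a) (mask (tail I) t) * + p    ∎

-- Each prime is stripped off together with the first entry; in the end `m` entries remain, too few
-- for `suc m` indices.
standard-¬zeroSum : ∀ (p : Vector ℕ k) b m → (∀ i → Prime (p i)) → (∀ i → Coprime (b i) (+ p i)) →
  ¬ ZeroSum (∏ p) (suc m) (standard m p b)
standard-¬zeroSum {zero} p b m pr co (I , I≡ , _) =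
  ℕ.1+n≰n (subst (_≤ m) I≡ (count≤l I))
standard-¬zeroSum {suc k} p b m pr co Z =
  standard-¬zeroSum (tail p) (tail b) m (pr ∘ suc) (co ∘ suc)
    (zeroSum-tail (standard m p b) _ (pr zero) (standard-suc m p b) p∤ Z)
  where
  -- The factor 1 is the empty partial product in front of the first term.
  p∤ : ¬ + p zero ∣ 1ℤ * b zero
  p∤ h = unit⇒∤ (pr zero) (coprime⇒unit (b zero) (co zero)) (≡-∣ (ℤ.*-identityˡ (b zero)) h)

-- Transfer along equivalence of sequences.

unit⇒U : Unit N a → U N a
unit⇒U {a = a} (w , h) = w , congruent h , congruent (≡-∣ (cong (_- 1ℤ) (ℤ.*-comm w a)) h)

U⇒unit : U N a → Unit N a
U⇒unit (w , congruent h , _) = w , h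

-- Two moduli: the weights are units modulo K, the congruences hold modulo N.
UnitEquivalent : (K N : ℕ) → Vector ℤ l → Vector ℤ k → Set
UnitEquivalent {l} {k} K N x y =
  ∃[ c ] Unit K c ×
  (Σ[ σ ∈ Permutation l k ] Σ[ a ∈ Vector ℤ l ]
    (∀ i → Unit K (a i)) × (∀ i → + N ∣ c * y (σ ⟨$⟩ʳ i) - a i * x i))

equivalent⇒unitEquivalent : (x : Vector ℤ l) (y : Vector ℤ k) →
  Equivalent N (U N) x y → UnitEquivalent N N x y
equivalent⇒unitEquivalent _ _ (c , uc , σ , a , ua , eq) =
  c , U⇒unit uc , σ , a , (λ i → U⇒unit (ua i)) , λ i → _≡ₙ_.n∣x-y (eq i)

unitEquivalent⇒equivalent : (x : Vector ℤ l) (y : Vector ℤ k) →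
  UnitEquivalent N N x y → Equivalent N (U N) x y
unitEquivalent⇒equivalent _ _ (c , uc , σ , a , ua , eq) =
  c , unit⇒U uc , σ , a , (λ i → unit⇒U (ua i)) , λ i → congruent (eq i)

-- All units move by multiples of `M`, so the congruences modulo `M` survive. This prepares for
-- multiplying the entries by `p`, which turns those congruences into ones modulo `p M`.
unitEquivalent-lift : Prime p → (x : Vector ℤ l) (y : Vector ℤ k) →
  UnitEquivalent M M x y → UnitEquivalent (p ℕ.* M) M x y
unitEquivalent-lift {p} {l} {M = M} pr x y (c , uc , σ , a , ua , eq) with unit-lift {a = c} pr uc
... | e , h = c + + M * e , unit-lift⇒unit {a = c} {e = e} pr uc h , σ , (λ i → a i + + M * f i) ,
  (λ i → unit-lift⇒unit {a = a i} {e = f i} pr (ua i) (proj₂ (unit-lift {a = a i} pr (ua i)))) ,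
  λ i → ≡-∣ (lemma (+ M) c e (y (σ ⟨$⟩ʳ i)) (a i) (f i) (x i))
    (∣m∣n⇒∣m+n (eq i) (∣m⇒∣m*n (e * y (σ ⟨$⟩ʳ i) - f i * x i) ∣-refl))
  where
  f : Vector ℤ l
  f i = proj₁ (unit-lift {a = a i} pr (ua i))
  lemma : ∀ m c e y a f x →
    c * y - a * x + m * (e * y - f * x) ≡ (c + m * e) * y - (a + m * f) * x
  lemma = solve-∀

if-both : ∀ (P : ℤ → ℤ → Set) b {x y} → P 0ℤ 0ℤ → P x y →
  P (if b then x else 0ℤ) (if b then y else 0ℤ)
if-both P true  P₀ Pxy = Pxy
if-both P false P₀ Pxy = P₀

-- As `v` inverts `a`, `x` is congruent to `v c y`; a weight `w` on `x` thus becomes the weight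
-- `w v c` on `y`.
∣-substitute : ∀ {d} w v a c x y → d ∣ v * a - 1ℤ → d ∣ c * y - a * x →
  d ∣ w * x - w * (v * c) * y
∣-substitute w v a c x y va≡1 cy≡ax =
  ≡-∣ (lemma₂ w x (v * c) y) (∣n⇒∣m*n w {x - v * c * y} (≡-∣ (lemma₁ c x v a y)
    (∣m∣n⇒∣m-n {m = - (v * a - 1ℤ) * x}
      (∣m⇒∣m*n {m = - (v * a - 1ℤ)} x (∣m⇒∣-m {m = v * a - 1ℤ} va≡1))
      (∣n⇒∣m*n v {c * y - a * x} cy≡ax))))
  where
  lemma₁ : ∀ c x v a y → - (v * a - 1ℤ) * x - v * (c * y - a * x) ≡ x - v * c * y
  lemma₁ = solve-∀
  lemma₂ : ∀ w x u y → w * (x - u * y) ≡ w * x - w * u * y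
  lemma₂ = solve-∀

zeroSum-equivalent : (x : Vector ℤ l) (y : Vector ℤ k) → UnitEquivalent N N x y →
  ZeroSum N m x → ZeroSum N m y
zeroSum-equivalent {l} {k} {N} {m} x y (c , uc , σ , a , ua , eq) (I , I≡ , w , uw , h) =
  J , J≡ , v , uv , ≡-∣ (sym (sum-permute (λ j → v j * mask J y j) σ)) (∣-sum-cong
    (λ i → w i * mask I x i) (λ i → v (σ ⟨$⟩ʳ i) * mask J y (σ ⟨$⟩ʳ i)) congr h)
  where
  inv : Vector ℤ l
  inv i = proj₁ (ua i)
  J : Vector Bool k
  J j = I (σ ⟨$⟩ˡ j)
  v′ : Vector ℤ l
  v′ i = w i * (inv i * c)
  v : Vector ℤ k
  v j = v′ (σ ⟨$⟩ˡ j)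
  uv : ∀ j → Unit N (v j)
  uv j = unit-* (uw i) (unit-* {a = inv i} (unit-inverse {a = a i} (ua i)) uc)
    where i = σ ⟨$⟩ˡ j
  J≡ : count J ≡ m
  J≡ = begin
    count J
      ≡⟨ Count.sum-permute (λ j → if J j then 1 else 0) σ ⟩
    Count.sum (λ i → if J (σ ⟨$⟩ʳ i) then 1 else 0)
      ≡⟨ Count.sum-cong-≗ (λ i → cong (λ i′ → if I i′ then 1 else 0) (Perm.inverseˡ σ {i})) ⟩
    count I
      ≡⟨ I≡ ⟩
    m ∎
    where open ≡-Reasoning
  congr : ∀ i → + N ∣ w i * mask I x i - v (σ ⟨$⟩ʳ i) * mask J y (σ ⟨$⟩ʳ i)
  congr i = ≡-∣
    (cong (λ i′ → w i * mask I x i - v′ i′ * (if I i′ then y (σ ⟨$⟩ʳ i) else 0ℤ))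
      (sym (Perm.inverseˡ σ)))
    (if-both (λ s t → + N ∣ w i * s - v′ i * t) (I i)
      (∣m∣n⇒∣m-n {m = w i * 0ℤ} (∣n⇒∣m*n (w i) (divides 0ℤ refl)) (∣n⇒∣m*n (v′ i) (divides 0ℤ refl)))
      (∣-substitute (w i) (inv i) (a i) c (x i) (y (σ ⟨$⟩ʳ i)) (proj₂ (ua i)) (eq i)))

-- Passing between `ZeroSum` and `HasZeroSumOfLength`.

count-lookup : (I : Subset l) → count (Vec.lookup I) ≡ Subset.∣ I ∣
count-lookup Vec.[] = refl
count-lookup (true  Vec.∷ I) = cong suc (count-lookup I)
count-lookup (false Vec.∷ I) = count-lookup I

nonempty : ∀ (I : Subset l) → Subset.∣ I ∣ ≡ suc m → Nonempty I
nonempty {l} I I≡ with nonempty? I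
... | yes ne = ne
... | no ¬ne =
  contradiction (trans (sym I≡) (trans (cong Subset.∣_∣ (Empty-unique ¬ne)) (∣⊥∣≡0 l))) λ ()

HasZeroSum⇒zeroSum : (x : Vector ℤ l) → HasZeroSumOfLength N (U N) m x → ZeroSum N m x
HasZeroSum⇒zeroSum {l} {N} {m} x (I , I≡ , _ , a , ua , congruent h) =
  Vec.lookup I , trans (count-lookup I) I≡ , a′ , ua′ ,
  ≡-∣ (trans (ℤ.+-identityʳ _) (sum-cong-≗ λ i → same i (Vec.lookup I i))) h
  where
  a′ : Vector ℤ l
  -- Outside `I` the given weights are arbitrary, so they are replaced by 1.
  a′ i = if Vec.lookup I i then a i else 1ℤ
  ua′ : ∀ i → Unit N (a′ i)
  ua′ i = go (Vec.lookup I i) refl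
    where
    go : ∀ b → Vec.lookup I i ≡ b → Unit N (if b then a i else 1ℤ)
    go true  eq = U⇒unit (ua i (lookup⇒[]= i I eq))
    go false _  = unit-1
  same : ∀ i b → (if b then a i * x i else 0ℤ) ≡ (if b then a i else 1ℤ) * (if b then x i else 0ℤ)
  same i true  = refl
  same i false = refl

-- The length is a successor because the index set has to be nonempty.
zeroSum⇒HasZeroSum : (x : Vector ℤ l) → ZeroSum N (suc m) x → HasZeroSumOfLength N (U N) (suc m) x
zeroSum⇒HasZeroSum {l} {N} {m} x (I , I≡ , a , ua , h) =
  I′ , I′≡ , nonempty I′ I′≡ , a , (λ i _ → unit⇒U (ua i)) ,
  congruent (≡-∣ (sym (trans (ℤ.+-identityʳ _) (sum-cong-≗ same))) h)
  where
  I′ = Vec.tabulate I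
  I′≡ : Subset.∣ I′ ∣ ≡ suc m
  I′≡ = trans (sym (count-lookup I′))
    (trans (Count.sum-cong-≗ (λ i → cong (if_then 1 else 0) (lookup∘tabulate I i))) I≡)
  same : ∀ i → (if Vec.lookup I′ i then a i * x i else 0ℤ) ≡ a i * mask I x i
  same i = trans (if-* (Vec.lookup I′ i) (a i) (x i))
    (cong (λ b → a i * (if b then x i else 0ℤ)) (lookup∘tabulate I i))

-- Sequences without zero-sum subsequences are standard.

unitEquivalent-∷ : Prime p → (x : Vector ℤ (suc l)) (i : Fin (suc l)) (t : Vector ℤ l) →
  ¬ + p ∣ x i → (∀ j → removeAt x i j ≡ t j * + p) →
  ∀ m (q : Vector ℕ k) b → UnitEquivalent (p ℕ.* M) M t (standard m q b) →
  ∃[ b₀ ] Coprime b₀ (+ p) × UnitEquivalent (p ℕ.* M) (p ℕ.* M) x (standard m (p ∷ q) (b₀ ∷ b))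
unitEquivalent-∷ {p} {l} {k} {M} pr x i t p∤xi x≡tp m q b (c , uc@(w , wc≡1) , σ , a , ua , eq) =
  b₀ , ∤⇒coprime pr p∤b₀ , c , uc , σ′ , a′ , ua′ , eq′
  where
  -- As `w` inverts `c`, this choice makes `c * b₀` congruent to `x i` with weight 1.
  b₀ = w * x i
  p∤b₀ : ¬ + p ∣ b₀
  p∤b₀ h = [ unit⇒∤ pr (unit-∣ (m∣m*n p M) (unit-inverse {a = c} uc)) , p∤xi ]′ (euclid {x = w} pr h)
  -- The entry prime to `p` goes to the head; the others follow `σ`, and their congruences modulo
  -- `M` get multiplied by `p`.
  σ′ = Perm.insert i zero σ
  σ′-i : σ′ ⟨$⟩ʳ i ≡ zero
  σ′-i with i ≟ i
  ... | yes _   = refl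
  ... | no i≢i = contradiction refl i≢i
  a′ : Vector ℤ (suc l)
  a′ = insertAt a i 1ℤ
  z = standard m (p ∷ q) (b₀ ∷ b)

  at : (P : Fin (suc l) → Set) → P i → (∀ j → P (punchIn i j)) → ∀ j → P j
  at P Pi Pp j with i ≟ j
  ... | yes refl = Pi
  ... | no i≢j   = subst P (punchIn-punchOut i≢j) (Pp (punchOut i≢j))

  ua′ : ∀ j → Unit (p ℕ.* M) (a′ j)
  ua′ = at _ (subst (Unit _) (sym (insertAt-lookup a i 1ℤ)) unit-1)
    λ j → subst (Unit _) (sym (insertAt-punchIn a i 1ℤ j)) (ua j)

  lemma₀ : ∀ w c x → (w * c - 1ℤ) * x ≡ c * (1ℤ * (w * x)) - 1ℤ * x
  lemma₀ = solve-∀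
  lemma₁ : ∀ p c z a t → (c * z - a * t) * p ≡ c * (z * p) - a * (t * p)
  lemma₁ = solve-∀

  Eq : Fin (suc l) → Set
  Eq j = + (p ℕ.* M) ∣ c * z (σ′ ⟨$⟩ʳ j) - a′ j * x j

  eq-i : Eq i
  eq-i = ≡-∣ (trans (lemma₀ w c (x i))
      (cong₂ (λ j a → c * z j - a * x i) (sym σ′-i) (sym (insertAt-lookup a i 1ℤ))))
    (∣m⇒∣m*n (x i) wc≡1)

  eq-punchIn : ∀ j → Eq (punchIn i j)
  eq-punchIn j = ≡-∣ (begin
      + p * (c * s - a j * t j)                 ≡⟨ ℤ.*-comm (+ p) _ ⟩
      (c * s - a j * t j) * + p                 ≡⟨ lemma₁ (+ p) c s (a j) (t j) ⟩
      c * (s * + p) - a j * (t j * + p)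
        ≡⟨ cong₂ (λ u v → c * u - a j * v) (standard-suc m (p ∷ q) (b₀ ∷ b) (σ ⟨$⟩ʳ j)) (x≡tp j) ⟨
      c * z (suc (σ ⟨$⟩ʳ j)) - a j * x (punchIn i j)
        ≡⟨ cong₂ (λ u v → c * z u - v * x (punchIn i j))
             (Perm.insert-punchIn i zero σ j) (insertAt-punchIn a i 1ℤ j) ⟨
      c * z (σ′ ⟨$⟩ʳ punchIn i j) - a′ (punchIn i j) * x (punchIn i j)   ∎)
    (∣-*-* (∣-refl {+ p}) (eq j))
    where
    open ≡-Reasoning
    s = standard m q b (σ ⟨$⟩ʳ j)

  eq′ : ∀ j → Eq j
  eq′ = at Eq eq-i eq-punchIn

1∣ : ∀ a → 1ℤ ∣ a
1∣ a = divides a (sym (ℤ.*-identityʳ a))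

-- The primes are quantified existentially, since the order in which they are split off depends on
-- the sequence.
IsStandard : ℕ → ℕ → ℕ → Vector ℤ l → Set
IsStandard N k m x =
  Σ[ p ∈ Vector ℕ k ] Σ[ b ∈ Vector ℤ k ]
    (∀ i → Prime (p i)) × N ≡ ∏ p × (∀ i → Coprime (b i) (+ p i)) ×
    UnitEquivalent N N x (standard m p b)

isStandard-∷ : Prime p → (x : Vector ℤ (suc l)) (i : Fin (suc l)) → ¬ + p ∣ x i →
  (h : ∀ j → + p ∣ removeAt x i j) →
  IsStandard M k m (quotient ∘ h) → IsStandard (p ℕ.* M) (suc k) m x
isStandard-∷ {p} {M = M} {m = m} pr x i p∤xi h (q , b , prq , M≡ , co , equiv) =
  extend (unitEquivalent-∷ {M = M} pr x i (quotient ∘ h) p∤xi (_∣_.equality ∘ h) m q b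
           (unitEquivalent-lift {M = M} pr (quotient ∘ h) (standard m q b) equiv))
  where
  extend :
    ∃[ b₀ ] Coprime b₀ (+ p) ×
      UnitEquivalent (p ℕ.* M) (p ℕ.* M) x (standard m (p ∷ q) (b₀ ∷ b)) →
    IsStandard (p ℕ.* M) _ m x
  extend (b₀ , co₀ , equiv′) =
    p ∷ q , b₀ ∷ b , (λ { zero → pr ; (suc i) → prq i }) ,
    cong (p ℕ.*_) M≡ , (λ { zero → co₀ ; (suc i) → co i }) , equiv′

-- A zero-sum subsequence of the quotients would scale back to one of `x`, so `¬Z` is inherited and
-- the induction continues with one prime and one entry fewer.
¬zeroSum⇒standard : (p : Vector ℕ k) → (∀ j → OddPrime (p j)) → 2 ℕ.* k ≤ suc m → l ≡ k ℕ.+ m →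
  (x : Vector ℤ l) → ¬ ZeroSum (∏ p) (suc m) x → IsStandard (∏ p) k m x
¬zeroSum⇒standard {zero} p op 2k≤m refl x ¬Z =
  [] , [] , (λ ()) , refl , (λ ()) ,
  -- The modulus is 1 here, so every congruence holds.
  1ℤ , unit-1 , Perm.id , const 1ℤ , (λ _ → unit-1) , λ _ → 1∣ _
¬zeroSum⇒standard {suc k} {m} {l} p op 2k≤m l≡ x ¬Z with ∀⊎∃ (λ j → two⊎atMostOne (p j) x)
... | inj₁ two = contradiction
  (zeroSum-two p op 2k≤m (subst (suc m ≤_) (sym l≡) (s≤s (ℕ.m≤n+m m k))) x two) ¬Z
... | inj₂ (j , few) = subst (λ N → IsStandard N (suc k) m x) (sym ∏p≡)
  (reduce few l≡ (¬Z ∘ subst (λ N → ZeroSum N (suc m) x) (sym ∏p≡)))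
  where
  ∏p≡ : ∏ p ≡ p j ℕ.* ∏ (removeAt p j)
  ∏p≡ = Product.sum-remove {i = j} p
  2k≤m′ : 2 ℕ.* k ≤ suc m
  2k≤m′ = ℕ.≤-trans (ℕ.*-monoʳ-≤ 2 (ℕ.n≤1+n k)) 2k≤m
  reduce : ∀ {l} {x : Vector ℤ l} → AtMostOne (p j) x → l ≡ suc k ℕ.+ m →
    ¬ ZeroSum (p j ℕ.* ∏ (removeAt p j)) (suc m) x →
    IsStandard (p j ℕ.* ∏ (removeAt p j)) (suc k) m x
  -- With no exceptional entry the quotients would have length `k + suc m` for `k` primes, exactly
  -- what `zeroSum-exists` asks for.
  reduce (none h) l≡ ¬Z = contradiction
    (zeroSum-quotient (proj₁ (op j)) h
      (zeroSum-exists (removeAt p j) (op ∘ punchIn j) 2k≤m′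
        (ℕ.≤-reflexive (trans (ℕ.+-suc k m) (sym l≡))) (quotient ∘ h))) ¬Z
  reduce {x = x} (one i p∤xi h) l≡ ¬Z = isStandard-∷ (proj₁ (op j)) x i p∤xi h
    (¬zeroSum⇒standard (removeAt p j) (op ∘ punchIn j) 2k≤m′ (ℕ.suc-injective l≡) (quotient ∘ h)
      λ Z → ¬Z (zeroSum-removeAt x i (zeroSum-quotient (proj₁ (op j)) h Z)))

-- Bounds and monotonicity for the Gao constant.

∣∏ : (p : Vector ℕ k) → ∀ i → p i ℕ.∣ ∏ p
∣∏ p zero    = ℕ.m∣m*n _
∣∏ p (suc i) = ℕ.∣n⇒∣m*n (p zero) (∣∏ (tail p) i)

oddPrime : 2 ∤ N → Prime p → p ℕ.∣ N → OddPrime p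
oddPrime {p = p} 2∤N pr p∣N =
  pr , ℕ.≤∧≢⇒< (ℕ.nonTrivial⇒n>1 p {{prime⇒nonTrivial pr}}) λ { refl → 2∤N p∣N }

-- Yields `2 k ≤ n`, the room for two indices per prime. Positivity is carried along because the
-- step bounds 2 by twice the remaining product.
∏-bound : (p : Vector ℕ k) → (∀ j → 2 < p j) → 0 < ∏ p × 2 ℕ.* k ≤ ∏ p
∏-bound {zero} p 2< = s≤s z≤n , z≤n
∏-bound {suc k} p 2< with ∏-bound (tail p) (2< ∘ suc)
... | 0<P , 2k≤P = ℕ.≤-trans 0<P (≤* (ℕ.≤-trans (s≤s z≤n) (2< zero))) , (begin
  2 ℕ.* suc k         ≡⟨ ℕ.*-suc 2 k ⟩
  2 ℕ.+ 2 ℕ.* k       ≤⟨ ℕ.+-mono-≤ (ℕ.*-monoʳ-≤ 2 0<P) 2k≤P ⟩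
  2 ℕ.* P ℕ.+ P       ≡⟨ ℕ.+-comm (2 ℕ.* P) P ⟩
  3 ℕ.* P             ≤⟨ ℕ.*-monoˡ-≤ P (2< zero) ⟩
  p zero ℕ.* P        ∎)
  where
  open ℕ.≤-Reasoning
  P = ∏ (tail p)
  ≤* : ∀ {q} → 1 ≤ q → P ≤ q ℕ.* P
  ≤* 1≤q = ℕ.≤-trans (ℕ.≤-reflexive (sym (ℕ.*-identityˡ P))) (ℕ.*-monoˡ-≤ P 1≤q)

gaoProperty-suc : GaoProperty N (U N) l → GaoProperty N (U N) (suc l)
gaoProperty-suc {N} G x with G (tail x)
... | I , I≡ , (i , i∈I) , a , ua , congruent h =
  Vec._∷_ false I , I≡ , (suc i , Vec.there i∈I) , 1ℤ ∷ a , ua′ ,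
  congruent (≡-∣ (cong (_- 0ℤ) (sym (ℤ.+-identityˡ s))) h)
  where
  s = sum (λ i → if Vec.lookup I i then a i * tail x i else 0ℤ)
  ua′ : ∀ j → j ∈ Vec._∷_ false I → U N ((1ℤ ∷ a) j)
  ua′ (suc j) (Vec.there j∈I) = ua j j∈I

-- Allows a single counterexample of length `k + n` to exclude all smaller lengths too.
gaoProperty-mono : ∀ {j} → j ℕ.≤′ l → GaoProperty N (U N) j → GaoProperty N (U N) l
gaoProperty-mono ℕ.≤′-refl G = G
gaoProperty-mono (ℕ.≤′-step j≤l) G = gaoProperty-suc (gaoProperty-mono j≤l G)

-- The Gao constant and the extremal sequences for a factored odd modulus `suc n`.

module _ {n} (2∤n : 2 ∤ suc n)
         (p : Vector ℕ k) (pr : ∀ i → Prime (p i)) (n≡∏p : suc n ≡ ∏ p) where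

  oddPrimes : ∀ i → OddPrime (p i)
  oddPrimes i = oddPrime 2∤n (pr i) (subst (p i ℕ.∣_) (sym n≡∏p) (∣∏ p i))

  2k≤n : 2 ℕ.* k ≤ suc n
  2k≤n = subst (2 ℕ.* k ≤_) (sym n≡∏p) (proj₂ (∏-bound p (proj₂ ∘ oddPrimes)))

  standard-¬HasZeroSum : ∀ b → (∀ i → Coprime (b i) (+ p i)) →
    ¬ HasZeroSumOfLength (suc n) (U (suc n)) (suc n) (standard n p b)
  standard-¬HasZeroSum b co Z = standard-¬zeroSum p b n pr co
    (subst (λ N → ZeroSum N (suc n) (standard n p b)) n≡∏p (HasZeroSum⇒zeroSum (standard n p b) Z))

  gaoConstant : IsGaoConstant (suc n) (U (suc n)) (suc (k ℕ.+ n))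
  gaoConstant = s≤s z≤n , holds , minimal
    where
    holds : GaoProperty (suc n) (U (suc n)) (suc (k ℕ.+ n))
    holds x = zeroSum⇒HasZeroSum x (subst (λ N → ZeroSum N (suc n) x) (sym n≡∏p)
      (zeroSum-exists p oddPrimes 2k≤n (ℕ.≤-reflexive (ℕ.+-suc k n)) x))
    minimal : ∀ j → 0 < j → GaoProperty (suc n) (U (suc n)) j → suc (k ℕ.+ n) ≤ j
    -- If `j ≤ k + n`, the property would extend to length `k + n`, where the standard sequence with
    -- all `b` equal to 1 violates it.
    minimal j _ G = ℕ.≰⇒> λ j≤ →
      standard-¬HasZeroSum (const 1ℤ) (λ i → ∤⇒coprime (pr i) (prime∤1 (pr i)))
        (gaoProperty-mono (ℕ.≤⇒≤′ j≤) G (standard n p (const 1ℤ)))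

  extremal⇒standard : ∀ {l} (S : Vector ℤ l) → IsGaoExtremal (suc n) (U (suc n)) S →
    Σ[ q ∈ Vector ℕ k ] Σ[ b ∈ Vector ℤ k ]
      (∀ i → Prime (q i)) × suc n ≡ ∏ q × (∀ i → Coprime (b i) (+ q i)) ×
      Equivalent (suc n) (U (suc n)) S (standard n q b)
  extremal⇒standard {l} S ((E , (0<E , G , min) , l≡) , ¬Z) =
    toEquivalent (subst (λ N → IsStandard N k n S) (sym n≡∏p)
      (¬zeroSum⇒standard p oddPrimes 2k≤n l≡k+n S
        (¬Z ∘ zeroSum⇒HasZeroSum S ∘ subst (λ N → ZeroSum N (suc n) S) (sym n≡∏p))))
    where
    toEquivalent : IsStandard (suc n) k n S → _
    toEquivalent (q , b , prq , n≡ , co , equiv) =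
      q , b , prq , n≡ , co , unitEquivalent⇒equivalent S (standard n q b) equiv
    E≡ : E ≡ suc (k ℕ.+ n)
    E≡ with gaoConstant
    ... | 0<E′ , G′ , min′ = ℕ.≤-antisym (min _ 0<E′ G′) (min′ E 0<E G)
    l≡k+n : l ≡ k ℕ.+ n
    l≡k+n = trans l≡ (cong (ℕ._∸ 1) E≡)

  standard⇒extremal : ∀ {l} (S : Vector ℤ l) b → (∀ i → Coprime (b i) (+ p i)) →
    Equivalent (suc n) (U (suc n)) S (standard n p b) → IsGaoExtremal (suc n) (U (suc n)) S
  standard⇒extremal S b co equiv@(_ , _ , σ , _) =
    -- The bijection `σ` forces the length of `S` to be `k + n`, one less than the Gao constant.
    (suc (k ℕ.+ n) , gaoConstant , Perm.↔⇒≡ σ) ,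
    λ Z → standard-¬HasZeroSum b co (zeroSum⇒HasZeroSum z
      (zeroSum-equivalent S z (equivalent⇒unitEquivalent S z equiv) (HasZeroSum⇒zeroSum S Z)))
    where z = standard n p b

∏-lookup : (ps : List ℕ) → ∏ (List.lookup ps) ≡ product ps
∏-lookup List.[] = refl
∏-lookup (q List.∷ ps) = cong (q ℕ.*_) (∏-lookup ps)

theorem1 : (n : ℕ) → 0 < n → 2 ∤ n → (l : ℕ) (S : Vector ℤ l) →
    IsGaoExtremal n (U n) S ⇔
    (∃[ k ] Σ[ p ∈ Vector ℕ k ] Σ[ b ∈ Vector ℤ k ]
    (∀ i → Prime (p i)) ×
    n ≡ ∏ p ×
    (∀ i → Coprime (b i) (+ p i)) ×
    Equivalent n (U n) S (standardSequence n p b))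
theorem1 (suc n) 0<n 2∤n l S = mk⇔
  -- Any prime factorisation fixes `k` and the Gao constant; the converse takes the primes of the
  -- given standard sequence.
  (λ ext → List.length factors , extremal⇒standard 2∤n (List.lookup factors)
    (λ i → All.lookup factorsPrime (∈-lookup i))
    (trans isFactorisation (sym (∏-lookup factors))) S ext)
  λ { (k , p , b , pr , n≡ , co , equiv) → standard⇒extremal 2∤n p pr n≡ S b co equiv }
  where open PrimeFactorisation (factorise (suc n))
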